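{- Let $A\in\mathcal{V}$ and let $\theta$ be a congruence of $A$ with $\theta\subseteq Rad(A)$. If $\theta$ has $CBLP$, then every set $\Omega'$ of atoms of the Boolean algebra $B(Con(A/\theta))$ is lifted by $p_\theta$ to a unique subset $\Omega$ of $B(Con(A))$, and $\Omega$ consists of atoms of $B(Con(A))$.
   Context: $\mathcal{V}$ is a congruence modular, semidegenerate variety (no nontrivial algebra has a one-element subalgebra) of finite signature, such that for every $B\in\mathcal{V}$ the set $K(B)$ of compact congruences is closed under the Freese–McKenzie commutator. $Con(A)$ is the congruence lattice with bounds $\Delta_A,\nabla_A$; $Rad(A)$ is the intersection of all maximal congruences of $A$; $B(Con(A))$ is the Boolean algebra of complemented elements of $Con(A)$. $p_\theta:A\to A/\theta$ is the canonical surjection, and $p_\theta^{\bullet}(\alpha)=(\alpha\vee\theta)/\theta$ for $\alpha\in Con(A)$; it restricts to a Boolean morphism $B(Con(A))\to B(Con(A/\theta))$. $p_\theta$ lifts $\Omega'\subseteq Con(A/\theta)$ to $\Omega\subseteq Con(A)$ if $\Omega'=\{p_\theta^{\bullet}(\alpha):\alpha\in\Omega\}$. The congruence $\theta$ has $CBLP$ if for every $\beta\in B(Con(A/\theta))$ there exists $\alpha\in B(Con(A))$ with $(\alpha\vee\theta)/\theta=\beta$. -}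

module Defs where

open import Level using (Level; _⊔_; suc; Lift; lift)
open import Data.Unit using (⊤; tt)
open import Data.Nat.Base using (ℕ)
open import Data.Fin.Base using (Fin)
open import Data.List.Base using (foldr; map)
open import Data.Product.Base using (Σ; ∃; ∃-syntax; _×_; _,_; proj₁; proj₂; swap; zip)
open import Data.Sum.Base using (_⊎_; inj₁; inj₂; [_,_]′)
open import Function.Base using (id; _∘_)
open import Function.Bundles using (_⇔_)
open import Relation.Binary.Core using (Rel; _⇒_)
open import Relation.Binary.Definitions using (_Respects_)
open import Relation.Binary.Bundles using (Setoid; Poset)
open import Relation.Binary.Lattice.Bundles using (BoundedLattice)
open import Relation.Nullary.Negation using (¬_)
open import Relation.Unary using (Pred; _∈_)

private
  variable
    a c ℓ ℓ₁ ℓ₂ r s p : Level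

-- The hypothesis on chains covers the empty chain, hence P is inhabited.

Zorn : ∀ c ℓ₁ ℓ₂ p → Set (suc (c ⊔ ℓ₁ ⊔ ℓ₂ ⊔ p))
Zorn c ℓ₁ ℓ₂ p =
  (P : Poset c ℓ₁ ℓ₂) → let open Poset P in
  (∀ (C : Pred Carrier p) →
     (∀ {x y} → x ∈ C → y ∈ C → x ≤ y ⊎ y ≤ x) →
     ∃[ u ] (∀ {x} → x ∈ C → x ≤ u)) →
  ∃[ m ] (∀ x → m ≤ x → x ≈ m)

module _ (L : BoundedLattice c ℓ₁ ℓ₂) where
  private module L = BoundedLattice L

  Modular : Set (c ⊔ ℓ₁ ⊔ ℓ₂)
  Modular = ∀ x y z → x L.≤ z → (x L.∨ (y L.∧ z)) L.≈ ((x L.∨ y) L.∧ z)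

  -- Membership in B(L).
  Complemented : Pred L.Carrier (c ⊔ ℓ₁)
  Complemented x = ∃[ y ] ((x L.∨ y) L.≈ L.⊤) × ((x L.∧ y) L.≈ L.⊥)

  -- Atoms of B(L), not of L: only complemented elements below x are tested.
  -- B(L) carries the order and the bottom element of L.
  AtomOfB : Pred L.Carrier (c ⊔ ℓ₁ ⊔ ℓ₂)
  AtomOfB x = Complemented x
            × ¬ (x L.≈ L.⊥)
            × (∀ y → Complemented y → y L.≤ x → y L.≈ L.⊥ ⊎ y L.≈ x)

  Maximal : Pred L.Carrier (c ⊔ ℓ₁ ⊔ ℓ₂)
  Maximal x = ¬ (x L.≈ L.⊤) × (∀ y → x L.≤ y → ¬ (y L.≈ L.⊤) → y L.≈ x)

  -- Subsets of L as a setoid: predicates have to respect the equality of L.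
  record Subset p : Set (c ⊔ ℓ₁ ⊔ suc p) where
    field
      member   : Pred L.Carrier p
      respects : member Respects L._≈_

open Subset public

record Signature : Set where
  field
    symbols : ℕ
    arity   : Fin symbols → ℕ

  Symbol : Set
  Symbol = Fin symbols

module _ (S : Signature) where
  open Signature S

  data Term (X : Set a) : Set a where
    var : X → Term X
    app : (f : Symbol) → (Fin (arity f) → Term X) → Term X

  record Algebra ℓ : Set (suc ℓ) where
    field
      setoid : Setoid ℓ ℓ
    open Setoid setoid public
    field
      op      : (f : Symbol) → (Fin (arity f) → Carrier) → Carrier
      op-cong : ∀ f {xs ys} → (∀ i → xs i ≈ ys i) → op f xs ≈ op f ys

    eval : {X : Set a} → (X → Carrier) → Term X → Carrier
    eval ρ (var x)    = ρ x
    eval ρ (app f ts) = op f (λ i → eval ρ (ts i))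

  Identities : ∀ ℓ → Set (suc ℓ)
  Identities ℓ = Rel (Term ℕ) ℓ

  infix 4 _⊨_
  _⊨_ : Algebra ℓ → Identities ℓ → Set ℓ
  A ⊨ E = ∀ {t u} → E t u → (ρ : ℕ → Carrier) → eval ρ t ≈ eval ρ u
    where open Algebra A

  -- Varieties as equational classes.
  IsVariety : Pred (Algebra ℓ) ℓ → Set (suc ℓ)
  IsVariety {ℓ} 𝒱 = Σ (Identities ℓ) λ E → ∀ A → A ∈ 𝒱 ⇔ A ⊨ E

module _ {S : Signature} where
  open Signature S

  module _ (A : Algebra S ℓ) where
    open Algebra A using (Carrier; _≈_; op)

    Nontrivial : Set ℓ
    Nontrivial = ∃[ x ] ∃[ y ] ¬ (x ≈ y)

    record Subalgebra : Set (suc ℓ) where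
      field
        universe : Pred Carrier ℓ
        resp     : universe Respects _≈_
        closed   : ∀ f {xs} → (∀ i → xs i ∈ universe) → op f xs ∈ universe

    OneElement : Pred Subalgebra ℓ
    OneElement U = ∃[ x ] (x ∈ universe × (∀ {y} → y ∈ universe → y ≈ x))
      where open Subalgebra U

    record Congruence r : Set (ℓ ⊔ suc r) where
      field
        rel        : Rel Carrier r
        reflexive  : _≈_ ⇒ rel
        symmetric  : ∀ {x y} → rel x y → rel y x
        transitive : ∀ {x y z} → rel x y → rel y z → rel x z
        compatible : ∀ f {xs ys} → (∀ i → rel (xs i) (ys i)) → rel (op f xs) (op f ys)

  module _ {A : Algebra S ℓ} where
    open Algebra A using (Carrier; _≈_; op; op-cong; eval)
    open Congruence

    infix 4 _⊑_ _≋_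
    _⊑_ : Congruence A r → Congruence A s → Set (ℓ ⊔ r ⊔ s)
    α ⊑ β = rel α ⇒ rel β

    _≋_ : Congruence A r → Congruence A s → Set (ℓ ⊔ r ⊔ s)
    α ≋ β = α ⊑ β × β ⊑ α

    data Generated (R : Rel Carrier r) : Rel Carrier (ℓ ⊔ r) where
      base       : ∀ {x y} → R x y → Generated R x y
      by-≈       : ∀ {x y} → x ≈ y → Generated R x y
      by-sym     : ∀ {x y} → Generated R x y → Generated R y x
      by-trans   : ∀ {x y z} → Generated R x y → Generated R y z → Generated R x z
      by-op      : ∀ f {xs ys} → (∀ i → Generated R (xs i) (ys i)) →
                   Generated R (op f xs) (op f ys)

    Cg : Rel Carrier r → Congruence A (ℓ ⊔ r)
    Cg R = record
      { rel        = Generated R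
      ; reflexive  = by-≈
      ; symmetric  = by-sym
      ; transitive = by-trans
      ; compatible = by-op
      }

    Cg-least : {R : Rel Carrier r} (δ : Congruence A s) → R ⇒ rel δ → Cg R ⊑ δ
    Cg-least δ R⇒δ (base x)       = R⇒δ x
    Cg-least δ R⇒δ (by-≈ x)       = reflexive δ x
    Cg-least δ R⇒δ (by-sym x)     = symmetric δ (Cg-least δ R⇒δ x)
    Cg-least δ R⇒δ (by-trans x y) = transitive δ (Cg-least δ R⇒δ x) (Cg-least δ R⇒δ y)
    Cg-least δ R⇒δ (by-op f x)    = compatible δ f (λ i → Cg-least δ R⇒δ (x i))

    infixr 6 _∨_
    _∨_ : Congruence A ℓ → Congruence A ℓ → Congruence A ℓ
    α ∨ β = Cg (λ x y → rel α x y ⊎ rel β x y)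

    infixr 7 _∧_
    _∧_ : Congruence A ℓ → Congruence A ℓ → Congruence A ℓ
    α ∧ β = record
      { rel        = λ x y → rel α x y × rel β x y
      ; reflexive  = λ x → reflexive α x , reflexive β x
      ; symmetric  = λ (x , y) → symmetric α x , symmetric β y
      ; transitive = zip (transitive α) (transitive β)
      ; compatible = λ f x → compatible α f (proj₁ ∘ x) , compatible β f (proj₂ ∘ x)
      }

    ⋁ : {I : Set ℓ} → (I → Congruence A ℓ) → Congruence A ℓ
    ⋁ φ = Cg (λ x y → ∃[ i ] rel (φ i) x y)

  module _ (A : Algebra S ℓ) where
    open Algebra A using (Carrier; _≈_; op; op-cong; eval)
      renaming (refl to ≈-refl; sym to ≈-sym; trans to ≈-trans)
    open Congruence

    Δ : Congruence A ℓ
    Δ = record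
      { rel = _≈_ ; reflexive = id ; symmetric = ≈-sym
      ; transitive = ≈-trans ; compatible = op-cong }

    ∇ : Congruence A ℓ
    ∇ = record
      { rel = λ _ _ → Lift ℓ ⊤ ; reflexive = λ _ → lift tt ; symmetric = λ _ → lift tt
      ; transitive = λ _ _ → lift tt ; compatible = λ _ _ → lift tt }

    Con : BoundedLattice (suc ℓ) ℓ ℓ
    Con = record
      { Carrier = Congruence A ℓ
      ; _≈_ = _≋_ ; _≤_ = _⊑_ ; _∨_ = _∨_ ; _∧_ = _∧_ ; ⊤ = ∇ ; ⊥ = Δ
      ; isBoundedLattice = record
        { isLattice = record
          { isPartialOrder = record
            { isPreorder = record
              { isEquivalence = record
                { refl  = id , id
                ; sym   = swap
                ; trans = λ (f , g) (h , k) → h ∘ f , g ∘ k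
                }
              ; reflexive = proj₁
              ; trans     = λ f g → g ∘ f
              }
            ; antisym = _,_
            }
          ; supremum = λ α β → base ∘ inj₁ , base ∘ inj₂ ,
                         λ γ f g → Cg-least γ [ f , g ]′
          ; infimum  = λ α β → proj₁ , proj₂ , λ γ f g x → f x , g x
          }
        ; maximum = λ _ _ → lift tt
        ; minimum = reflexive
        }
      }

    -- The intersection of a family indexed by congruences lives one universe up.
    Rad : Congruence A (suc ℓ)
    Rad = record
      { rel        = λ x y → (φ : Congruence A ℓ) → Maximal Con φ → rel φ x y
      ; reflexive  = λ x φ _ → reflexive φ x
      ; symmetric  = λ x φ m → symmetric φ (x φ m)
      ; transitive = λ x y φ m → transitive φ (x φ m) (y φ m)
      ; compatible = λ f x φ m → compatible φ f (λ i → x i φ m)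
      }

    -- Families indexed by Set ℓ suffice: every congruence is the join of the
    -- ℓ-small family of principal congruences below it.
    Compact : Pred (Congruence A ℓ) (suc ℓ)
    Compact α = {I : Set ℓ} (φ : I → Congruence A ℓ) → α ⊑ ⋁ φ →
                ∃[ is ] α ⊑ foldr _∨_ Δ (map φ is)

  module _ {A : Algebra S ℓ} where
    open Algebra A using (Carrier; _≈_; op; eval)
    open Congruence

    -- The term condition C(α,β;δ): every matrix
    --   t(a,b)   t(a,b′)
    --   t(a′,b)  t(a′,b′)      with a α a′ and b β b′ componentwise
    -- whose first row lies in δ has its second row in δ.
    Centralizes : Congruence A ℓ → Congruence A ℓ → Rel Carrier r → Set (ℓ ⊔ r)
    Centralizes α β δ =
      ∀ {m n} (t : Term S (Fin m ⊎ Fin n)) {a a′ : Fin m → Carrier} {b b′ : Fin n → Carrier} →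
      (∀ i → rel α (a i) (a′ i)) → (∀ j → rel β (b j) (b′ j)) →
      δ (eval [ a  , b ]′ t) (eval [ a  , b′ ]′ t) →
      δ (eval [ a′ , b ]′ t) (eval [ a′ , b′ ]′ t)

    -- The inductively generated least congruence δ with C(α,β;δ); see
    -- commutator-centralizes and commutator-least.
    data Commutator (α β : Congruence A ℓ) : Rel Carrier ℓ where
      central    : ∀ {m n} (t : Term S (Fin m ⊎ Fin n))
                   {a a′ : Fin m → Carrier} {b b′ : Fin n → Carrier} →
                   (∀ i → rel α (a i) (a′ i)) → (∀ j → rel β (b j) (b′ j)) →
                   Commutator α β (eval [ a  , b ]′ t) (eval [ a  , b′ ]′ t) →
                   Commutator α β (eval [ a′ , b ]′ t) (eval [ a′ , b′ ]′ t)
      by-≈       : ∀ {x y} → x ≈ y → Commutator α β x y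
      by-sym     : ∀ {x y} → Commutator α β x y → Commutator α β y x
      by-trans   : ∀ {x y z} → Commutator α β x y → Commutator α β y z → Commutator α β x z
      by-op      : ∀ f {xs ys} → (∀ i → Commutator α β (xs i) (ys i)) →
                   Commutator α β (op f xs) (op f ys)

    [_,_] : Congruence A ℓ → Congruence A ℓ → Congruence A ℓ
    [ α , β ] = record
      { rel        = Commutator α β
      ; reflexive  = by-≈
      ; symmetric  = by-sym
      ; transitive = by-trans
      ; compatible = by-op
      }

    commutator-centralizes : ∀ α β → Centralizes α β (rel [ α , β ])
    commutator-centralizes α β = central

    commutator-least : ∀ α β (δ : Congruence A r) → Centralizes α β (rel δ) → [ α , β ] ⊑ δ
    commutator-least α β δ C (central t a b x) = C t a b (commutator-least α β δ C x)
    commutator-least α β δ C (by-≈ x)          = reflexive δ x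
    commutator-least α β δ C (by-sym x)        = symmetric δ (commutator-least α β δ C x)
    commutator-least α β δ C (by-trans x y)    =
      transitive δ (commutator-least α β δ C x) (commutator-least α β δ C y)
    commutator-least α β δ C (by-op f x)       =
      compatible δ f (λ i → commutator-least α β δ C (x i))

  module _ (𝒱 : Pred (Algebra S ℓ) ℓ) where

    CongruenceModular : Set (suc ℓ)
    CongruenceModular = ∀ B → B ∈ 𝒱 → Modular (Con B)

    Semidegenerate : Set (suc ℓ)
    Semidegenerate = ∀ B → B ∈ 𝒱 → Nontrivial B → ¬ ∃ (OneElement B)

    CompactClosedUnderCommutator : Set (suc ℓ)
    CompactClosedUnderCommutator =
      ∀ B → B ∈ 𝒱 → ∀ α β → Compact B α → Compact B β → Compact B [ α , β ]

  -- A quotient keeps the carrier and replaces the equality.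
  infixl 8 _/_
  _/_ : (A : Algebra S ℓ) → Congruence A ℓ → Algebra S ℓ
  A / θ = record
    { setoid = record
      { Carrier = Carrier
      ; _≈_ = rel
      ; isEquivalence = record
        { refl = reflexive refl ; sym = symmetric ; trans = transitive }
      }
    ; op      = op
    ; op-cong = compatible
    }
    where
    open Algebra A using (Carrier; refl; op)
    open Congruence θ

  module _ {A : Algebra S ℓ} where
    open Congruence

    -- φ/θ = {(x/θ , y/θ) : (x , y) ∈ φ}; x and x/θ are the same element of the carrier.
    quot : (θ φ : Congruence A ℓ) → θ ⊑ φ → Congruence (A / θ) ℓ
    quot θ φ θ⊑φ = record
      { rel        = rel φ
      ; reflexive  = θ⊑φ
      ; symmetric  = symmetric φ
      ; transitive = transitive φ
      ; compatible = compatible φ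
      }

    p• : (θ : Congruence A ℓ) → Congruence A ℓ → Congruence (A / θ) ℓ
    p• θ α = quot θ (α ∨ θ) (base ∘ inj₂)

    CBLP : Pred (Congruence A ℓ) (suc ℓ)
    CBLP θ = ∀ β → Complemented (Con (A / θ)) β →
             ∃[ α ] Complemented (Con A) α × p• θ α ≋ β

    Lifts : (θ : Congruence A ℓ) → Subset (Con (A / θ)) p → Subset (Con A) p → Set (suc ℓ ⊔ p)
    Lifts θ Ω′ Ω = ∀ β → β ∈ member Ω′ ⇔ (∃[ α ] α ∈ member Ω × p• θ α ≋ β)

{-# OPTIONS --safe #-}

-- Everything rests on two facts about complementary congruences γ, γ′ of A:
--
--   (1) (γ ∨ δ) ∧ (γ′ ∨ δ) ≤ δ for every congruence δ;
--   (2) if χ ∨ θ = ∇ and θ ≤ Rad(A), then χ = ∇.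
--
-- For (1), write C(α,β;δ) if the congruence D(α,β) that is generated on the subalgebra
-- β of A × A by the pairs ((x,x),(y,y)) with x α y leaves the subset δ ∩ β of β invariant.
-- The shifting lemma gives C(γ,γ′;δ) and C(γ′,γ;δ); C is additive in its first argument
-- and, by modularity of Con(α) and Con(β), symmetric in α and β, so C(∇,ε;δ) holds
-- for ε = (γ ∨ δ) ∧ (γ′ ∨ δ).  The diagonal is a one-element subalgebra of the
-- quotient of ε by D(∇,ε), so semidegeneracy makes D(∇,ε) the full congruence and ε ≤ δ.
--
-- For (2), semidegeneracy shows that ∇ is generated by the finitely many pairs
-- (a , f(a,…,a)), so Zorn's lemma puts every proper congruence below a maximal one.
--
-- By (1), p• maps B(Con A) to B(Con(A/θ)).  If γ ∨ θ ≤ δ ∨ θ, then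
-- γ′ ∨ δ ∨ θ = ∇, hence γ′ ∨ δ = ∇ by (2) and γ ≤ δ by (1); so p• reflects the order
-- on B(Con A).  CBLP makes it onto, and an isomorphism of posets lifts sets of atoms.

module Submission where

open import Defs
open import Level using (Level; suc; _⊔_; Lift; lift; lower)
open import Axiom.ExcludedMiddle using (ExcludedMiddle)
open import Axiom.DoubleNegationElimination using (em⇒dne)
open import Data.Bool.Base using (true; false; if_then_else_)
open import Data.Fin.Base using (Fin; zero)
open import Data.Nat.Base using (ℕ; zero)
open import Data.Product.Base using (Σ; ∃-syntax; _×_; _,_; proj₁; proj₂; swap; map₂)
open import Data.Sum.Base using (_⊎_; inj₁; inj₂; [_,_]′)
import Data.Sum.Base as Sum
open import Data.Unit.Base using (tt) renaming (⊤ to Unit)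
open import Data.Vec.Functional using (_∷_; head; tail)
open import Function.Base using (id; _∘_; _on_)
open import Function.Bundles using (mk⇔; module Equivalence)
open import Relation.Binary.Bundles using (Poset)
open import Relation.Binary.Core using (Rel; _⇒_)
open import Relation.Binary.Construct.Closure.ReflexiveTransitive using (Star; ε; _◅_; _◅◅_; gmap; reverse)
open import Relation.Binary.PropositionalEquality.Core using (_≡_; refl)
open import Relation.Nullary.Decidable.Core using (True; toWitness; fromWitness)
open import Relation.Nullary.Negation using (¬_)
open import Relation.Unary using (Pred; _∈_; _⊆_; _≐_)

open Congruence

private
  variable
    ℓ i p q r : Level
    S : Signature

Preserves : {X : Set ℓ} → Rel X r → Pred X p → Set (ℓ ⊔ r ⊔ p)
Preserves R P = ∀ {x y} → R x y → P x → P y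

-- Homomorphisms and varieties

record Hom (B C : Algebra S ℓ) : Set ℓ where
  private
    module B = Algebra B
    module C = Algebra C
  field
    fun  : B.Carrier → C.Carrier
    cong : ∀ {x y} → x B.≈ y → fun x C.≈ fun y
    pres : ∀ f xs → fun (B.op f xs) C.≈ C.op f (fun ∘ xs)

open Hom

eval-hom : {B C : Algebra S ℓ} (h : Hom B C) {X : Set r} (ρ : X → Algebra.Carrier B) (t : Term S X) →
           Algebra._≈_ C (fun h (Algebra.eval B ρ t)) (Algebra.eval C (fun h ∘ ρ) t)
eval-hom {C = C} h ρ (var x)    = Algebra.refl C
eval-hom {C = C} h ρ (app f ts) =
  Algebra.trans C (pres h f _) (Algebra.op-cong C f (λ i → eval-hom h ρ (ts i)))

pullback : {B C : Algebra S ℓ} → Hom B C → Congruence C ℓ → Congruence B ℓ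
pullback {C = C} h φ = record
  { rel        = rel φ on fun h
  ; reflexive  = reflexive φ ∘ cong h
  ; symmetric  = symmetric φ
  ; transitive = transitive φ
  ; compatible = λ f xs∼ys →
      transitive φ (reflexive φ (pres h f _))
        (transitive φ (compatible φ f xs∼ys) (reflexive φ (Algebra.sym C (pres h f _))))
  }

quotient-hom : {A : Algebra S ℓ} (θ : Congruence A ℓ) → Hom A (A / θ)
quotient-hom {A = A} θ = record
  { fun = id ; cong = reflexive θ ; pres = λ f xs → reflexive θ (Algebra.refl A) }

-- The congruence `β` as a subalgebra of `A × A`; equality ignores the membership proof.
Pairs : {A : Algebra S ℓ} → Congruence A ℓ → Algebra S ℓ
Pairs {A = A} β = record
  { setoid = record
    { Carrier = ∃[ x ] ∃[ y ] rel β x y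
    ; _≈_ = λ (x , y , _) (x′ , y′ , _) → x ≈ x′ × y ≈ y′
    ; isEquivalence = record
      { refl  = A.refl , A.refl
      ; sym   = λ (e , e′) → A.sym e , A.sym e′
      ; trans = λ (e , e′) (d , d′) → A.trans e d , A.trans e′ d′
      }
    }
  ; op      = λ f ps → op f (proj₁ ∘ ps) , op f (proj₁ ∘ proj₂ ∘ ps) ,
                       compatible β f (proj₂ ∘ proj₂ ∘ ps)
  ; op-cong = λ f es → op-cong f (proj₁ ∘ es) , op-cong f (proj₂ ∘ es)
  }
  where
  module A = Algebra A
  open A using (_≈_; op; op-cong)

module _ {A : Algebra S ℓ} (β : Congruence A ℓ) where
  open Algebra A using () renaming (refl to ≈-refl)

  π₁ π₂ : Hom (Pairs β) A
  π₁ = record { fun = proj₁ ; cong = proj₁ ; pres = λ f ps → ≈-refl }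
  π₂ = record { fun = proj₁ ∘ proj₂ ; cong = proj₂ ; pres = λ f ps → ≈-refl }

  diagonal : Hom A (Pairs β)
  diagonal = record
    { fun  = λ x → x , x , reflexive β ≈-refl
    ; cong = λ e → e , e
    ; pres = λ f xs → ≈-refl , ≈-refl
    }

module _ {𝒱 : Pred (Algebra S ℓ) ℓ} (variety : IsVariety S 𝒱) {A : Algebra S ℓ} (A∈𝒱 : A ∈ 𝒱) where
  private
    E = proj₁ variety
    A⊨E : _⊨_ S A E
    A⊨E = Equivalence.to (proj₂ variety A) A∈𝒱

  quotient∈𝒱 : (θ : Congruence A ℓ) → A / θ ∈ 𝒱
  quotient∈𝒱 θ = Equivalence.from (proj₂ variety (A / θ)) λ {t} {u} Etu ρ →
    transitive θ (symmetric θ (eval-hom (quotient-hom θ) ρ t))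
      (transitive θ (reflexive θ (A⊨E Etu ρ)) (eval-hom (quotient-hom θ) ρ u))

  pairs∈𝒱 : (β : Congruence A ℓ) → Pairs β ∈ 𝒱
  pairs∈𝒱 β = Equivalence.from (proj₂ variety (Pairs β)) λ Etu ρ →
    through (π₁ β) Etu ρ , through (π₂ β) Etu ρ
    where
    open Algebra A using (_≈_; sym; trans)
    through : (h : Hom (Pairs β) A) → ∀ {t u} → E t u → ∀ ρ →
              fun h (Algebra.eval (Pairs β) ρ t) ≈ fun h (Algebra.eval (Pairs β) ρ u)
    through h {t} {u} Etu ρ =
      trans (eval-hom h ρ t) (trans (A⊨E Etu (fun h ∘ ρ)) (sym (eval-hom h ρ u)))

-- Joins of tolerances

record IsTolerance (B : Algebra S ℓ) (Q : Rel (Algebra.Carrier B) q) : Set (ℓ ⊔ q) where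
  open Algebra B using (_≈_; op)
  field
    refl′   : _≈_ ⇒ Q
    sym′    : ∀ {x y} → Q x y → Q y x
    compat′ : ∀ f {xs ys} → (∀ i → Q (xs i) (ys i)) → Q (op f xs) (op f ys)

congruence-tolerance : {B : Algebra S ℓ} (φ : Congruence B r) → IsTolerance B (rel φ)
congruence-tolerance φ = record { refl′ = reflexive φ ; sym′ = symmetric φ ; compat′ = compatible φ }

module _ {B : Algebra S ℓ} {I : Set i} (i₀ : I) {Q : I → Rel (Algebra.Carrier B) q}
         (tol : ∀ i → IsTolerance B (Q i)) where
  open Algebra B using (Carrier; op) renaming (refl to ≈-refl)
  open module T i = IsTolerance (tol i)

  private
    Step : Rel Carrier (i ⊔ q)
    Step x y = ∃[ i ] Q i x y

    -- One coordinate is changed at a time.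
    star-op : ∀ n (g : (Fin n → Carrier) → Carrier) →
              (∀ i {xs ys} → (∀ j → Q i (xs j) (ys j)) → Q i (g xs) (g ys)) →
              ∀ xs ys → (∀ j → Star Step (xs j) (ys j)) → Star Step (g xs) (g ys)
    star-op zero    g g-compat xs ys _     = (i₀ , g-compat i₀ λ ()) ◅ ε
    star-op (ℕ.suc n) g g-compat xs ys steps =
      -- Tuples that agree pointwise need not be equal, so a step of index `i₀` leads from `xs` to
      -- `head xs ∷ tail xs`; the last step does the same for `ys`.
      (i₀ , g-compat i₀ λ { zero → refl′ i₀ ≈-refl ; (Fin.suc j) → refl′ i₀ ≈-refl }) ◅
      gmap (λ x → g (x ∷ tail xs))
           (λ (i , s) → i , g-compat i λ { zero → s ; (Fin.suc j) → refl′ i ≈-refl })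
           (steps zero) ◅◅
      star-op n (λ zs → g (head ys ∷ zs))
              (λ i s → g-compat i λ { zero → refl′ i ≈-refl ; (Fin.suc j) → s j })
              (tail xs) (tail ys) (steps ∘ Fin.suc) ◅◅
      (i₀ , g-compat i₀ λ { zero → refl′ i₀ ≈-refl ; (Fin.suc j) → refl′ i₀ ≈-refl }) ◅ ε

  tolerance-closure : Congruence B (ℓ ⊔ i ⊔ q)
  tolerance-closure = record
    { rel        = Star Step
    ; reflexive  = λ x≈y → (i₀ , refl′ i₀ x≈y) ◅ ε
    ; symmetric  = reverse (map₂ λ {i} → sym′ i)
    ; transitive = _◅◅_
    ; compatible = λ f {xs} {ys} → star-op _ (op f) (λ i → compat′ i f) xs ys
    }

  closure-preserves : {P : Pred Carrier p} → (∀ i → Preserves (Q i) P) →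
                      Preserves (rel tolerance-closure) P
  closure-preserves Q-pres ε               = id
  closure-preserves Q-pres ((i , s) ◅ ss) = closure-preserves Q-pres ss ∘ Q-pres i s

-- Induction on `Generated` would fail at `by-op`. The join is embedded into chains of `φ`- and
-- `ψ`-steps instead, and `P` passes along these step by step.
join-preserves : {B : Algebra S ℓ} {P : Pred (Algebra.Carrier B) p} (φ ψ : Congruence B ℓ) →
                 Preserves (rel φ) P → Preserves (rel ψ) P → Preserves (rel (φ ∨ ψ)) P
join-preserves {B = B} φ ψ φ-pres ψ-pres =
  closure-preserves true tol (λ { true → φ-pres ; false → ψ-pres }) ∘
  Cg-least (tolerance-closure true tol) λ { (inj₁ s) → (true , s) ◅ ε ; (inj₂ s) → (false , s) ◅ ε }
  where
  tol : ∀ b → IsTolerance B (rel (if b then φ else ψ))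
  tol b = congruence-tolerance (if b then φ else ψ)

-- Centrality in congruence modular varieties

-- Gumm's shifting lemma: the path `c`, `a`, `b`, `d` puts `(c , d)` into `((α ∧ ψ) ∨ β) ∧ α`, which
-- by modularity is `(α ∧ ψ) ∨ (β ∧ α)`, and both joinands are below `ψ`.
shifting : {B : Algebra S ℓ} → Modular (Con B) →
           (α β ψ : Congruence B ℓ) → α ∧ β ⊑ ψ →
           ∀ {a b c d} → rel α a b → rel α c d → rel β a c → rel β b d → rel ψ a b → rel ψ c d
shifting modular α β ψ α∧β⊑ψ aαb cαd aβc bβd aψb =
  Cg-least ψ [ proj₂ , α∧β⊑ψ ∘ swap ]′
    (proj₂ (modular (α ∧ ψ) β α proj₁)
      ( by-trans (base (inj₂ (symmetric β aβc))) (by-trans (base (inj₁ (aαb , aψb))) (base (inj₂ bβd)))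
      , cαd))

module _ {A : Algebra S ℓ} where
  open Algebra A using (Carrier) renaming (refl to ≈-refl)

  private
    refl-in : (φ : Congruence A ℓ) → ∀ {x} → rel φ x x
    refl-in φ = reflexive φ ≈-refl

  D : (α β : Congruence A ℓ) → Congruence (Pairs β) ℓ
  D α β = Cg λ p q → ∃[ x ] ∃[ y ] rel α x y × p ≡ fun (diagonal β) x × q ≡ fun (diagonal β) y

  D-base : (α β : Congruence A ℓ) → α ⊑ pullback (diagonal β) (D α β)
  D-base α β xαy = base (_ , _ , xαy , refl , refl)

  D-least : (α β : Congruence A ℓ) (φ : Congruence (Pairs β) r) →
            (∀ {x y} → rel α x y → rel φ (fun (diagonal β) x) (fun (diagonal β) y)) → D α β ⊑ φ
  D-least α β φ α⊑φ = Cg-least φ λ { (_ , _ , xαy , refl , refl) → α⊑φ xαy }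

  D⊑π₁ : (α β : Congruence A ℓ) → D α β ⊑ pullback (π₁ β) α
  D⊑π₁ α β = D-least α β (pullback (π₁ β) α) id

  D⊑π₂ : (α β : Congruence A ℓ) → D α β ⊑ pullback (π₂ β) α
  D⊑π₂ α β = D-least α β (pullback (π₂ β) α) id

  _holds-in_ : Congruence A ℓ → (β : Congruence A ℓ) → Pred (Algebra.Carrier (Pairs β)) ℓ
  (δ holds-in β) (x , y , _) = rel δ x y

  C : (α β δ : Congruence A ℓ) → Set ℓ
  C α β δ = Preserves (rel (D α β)) (δ holds-in β)

  C-mono : (α α′ β δ : Congruence A ℓ) → α ⊑ α′ → C α′ β δ → C α β δ
  C-mono α α′ β δ α⊑α′ c = c ∘ D-least α β (D α′ β) (D-base α′ β ∘ α⊑α′)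

  -- Pulled back along the diagonal, `D α β ∨ D α′ β` becomes a congruence of `A` above `α` and
  -- `α′`, hence above `α ∨ α′`; so it contains `D (α ∨ α′) β`.
  C-join : (α α′ β δ : Congruence A ℓ) → C α β δ → C α′ β δ → C (α ∨ α′) β δ
  C-join α α′ β δ c c′ =
    join-preserves (D α β) (D α′ β) c c′ ∘
    D-least (α ∨ α′) β (D α β ∨ D α′ β)
      (Cg-least (pullback (diagonal β) (D α β ∨ D α′ β))
        [ base ∘ inj₁ ∘ D-base α β , base ∘ inj₂ ∘ D-base α′ β ]′)

  C-self : (β δ : Congruence A ℓ) → C δ β δ
  C-self β δ d xδy =
    transitive δ (symmetric δ (D⊑π₁ δ β d)) (transitive δ xδy (D⊑π₂ δ β d))

  -- The matrix with rows `(x , y)` and `(z , w)` has its rows in `β` and its columns in `α`, as the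
  -- shifting lemma requires.
  C-meet : Modular (Con A) → (α β δ : Congruence A ℓ) → α ∧ β ⊑ δ → C α β δ
  C-meet modular α β δ α∧β⊑δ {_ , _ , xβy} {_ , _ , zβw} d xδy =
    shifting modular β α δ (α∧β⊑δ ∘ swap) xβy zβw (D⊑π₁ α β d) (D⊑π₂ α β d) xδy

  module _ (α β : Congruence A ℓ) (modular-β : Modular (Con (Pairs β))) where

    private
      δ₁ δ₂ : Congruence A ℓ → Congruence (Pairs β) ℓ
      δ₁ = pullback (π₁ β)
      δ₂ = pullback (π₂ β)

    -- (a , b) D (a , b′) is shifted along the second coordinate to (b , b) D (b , b′).
    C-up : (δ δ′ : Congruence A ℓ) → δ ⊑ δ′ → C α β δ → C α β δ′
    C-up δ δ′ δ⊑δ′ c {x , y , xβy} {z , w , zβw} d xδ′y =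
      -- The corners `(x , x)`, `(x , y)`, `(z , z)`, `(z , w)` carry `x δ′ y` to `z δ′ w`, once
      -- `D`-related pairs with equal first coordinates are known to have `δ′`-related second ones.
      shifting modular-β (δ₁ (Δ A)) (D α β) (δ₂ δ′) kernel
        {x , x , refl-in β} {x , y , xβy} {z , z , refl-in β} {z , w , zβw}
        ≈-refl ≈-refl (D-base α β (D⊑π₁ α β d)) d xδ′y
      where
      kernel : δ₁ (Δ A) ∧ D α β ⊑ δ₂ δ′
      kernel {a , b , aβb} {a′ , b′ , a′βb′} (a≈a′ , d′) = δ⊑δ′
        (c (shifting modular-β (δ₁ (Δ A)) (δ₂ (Δ A)) (D α β) by-≈
             {a , b , aβb} {a′ , b′ , a′βb′} {b , b , refl-in β}
             {b , b′ , transitive β (symmetric β aβb) (transitive β (reflexive β a≈a′) a′βb′)}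
             a≈a′ ≈-refl ≈-refl ≈-refl d′)
           (refl-in δ))

    -- Read a 2 × 2 matrix with rows in α and columns in β by its columns instead of its rows.
    private
      Transposed : Rel (Algebra.Carrier (Pairs α)) ℓ
      Transposed (x , z , _) (y , w , _) =
        Σ (rel β x y) λ xβy → Σ (rel β z w) λ zβw → rel (D α β) (x , y , xβy) (z , w , zβw)

      -- Intersecting with the converse gives symmetry without the automorphism of `Pairs β` that
      -- swaps coordinates.
      Q : Unit → Rel (Algebra.Carrier (Pairs α)) ℓ
      Q _ u v = Transposed u v × Transposed v u

      Q-≈ : ∀ {u v} → Algebra._≈_ (Pairs α) u v → Transposed u v
      Q-≈ {x , z , xαz} (x≈y , z≈w) =
        reflexive β x≈y , reflexive β z≈w ,
        -- The path is `(x , y)`, `(x , x)`, `(z , z)`, `(z , w)`.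
        by-trans (by-≈ (≈-refl , Algebra.sym A x≈y))
          (by-trans (D-base α β xαz) (by-≈ (≈-refl , z≈w)))

      Q-op : ∀ f {us vs} → (∀ i → Transposed (us i) (vs i)) →
             Transposed (Algebra.op (Pairs α) f us) (Algebra.op (Pairs α) f vs)
      Q-op f t = compatible β f (proj₁ ∘ t) , compatible β f (proj₁ ∘ proj₂ ∘ t) ,
                 by-op f (proj₂ ∘ proj₂ ∘ t)

      Q-tolerance : ∀ i → IsTolerance (Pairs α) (Q i)
      Q-tolerance _ = record
        { refl′   = λ {u} {v} e → Q-≈ {u} {v} e , Q-≈ {v} {u} (Algebra.sym (Pairs α) {u} {v} e)
        ; sym′    = swap
        ; compat′ = λ f {us} {vs} t →
            Q-op f {us} {vs} (proj₁ ∘ t) , Q-op f {vs} {us} (proj₂ ∘ t)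
        }

      Q-diagonal : ∀ {x y} → rel β x y → Transposed (fun (diagonal α) x) (fun (diagonal α) y)
      Q-diagonal xβy = xβy , xβy , by-≈ (≈-refl , ≈-refl)

    -- With δ ∧ β in place of δ, the pair (y , w) below lies in β.
    C-transpose : (δ : Congruence A ℓ) → C α β δ → C β α (δ ∧ β)
    C-transpose δ c =
      closure-preserves tt Q-tolerance {P = (δ ∧ β) holds-in α}
        (λ _ {u} {v} s → Q-preserves {u} {v} (proj₁ s)) ∘
      D-least β α (tolerance-closure tt Q-tolerance)
        (λ xβy → (tt , Q-diagonal xβy , Q-diagonal (symmetric β xβy)) ◅ ε)
      where
      δ′ : Congruence A ℓ
      δ′ = δ ∧ β

      ψ : Congruence (Pairs β) ℓ
      ψ = D α β ∨ (δ₁ δ′ ∧ δ₂ δ′)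

      ψ-preserves : Preserves (rel ψ) (δ holds-in β)
      ψ-preserves = join-preserves (D α β) (δ₁ δ′ ∧ δ₂ δ′) c
        λ ((xδz , _) , (yδw , _)) xδy → transitive δ (symmetric δ xδz) (transitive δ xδy yδw)

      Q-preserves : Preserves Transposed (δ′ holds-in α)
      Q-preserves {x , z , _} {y , w , _} (xβy , zβw , d) xδ′z =
        -- The related pair `(x , y)`, `(z , w)` is shifted to `(y , y)`, `(y , w)`; invariance
        -- under `ψ` then turns `y δ y` into `y δ w`.
        ψ-preserves (shifting modular-β (δ₁ δ′) (δ₂ δ′) ψ (base ∘ inj₂)
          {x , y , xβy} {z , w , zβw} {y , y , refl-in β} {y , w , yβw}
          xδ′z (refl-in δ′) (refl-in δ′) (refl-in δ′) (base (inj₁ d))) (refl-in δ)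
        , yβw
        where
        yβw : rel β y w
        yβw = transitive β (symmetric β xβy) (transitive β (proj₂ xδ′z) zβw)

  -- `C-up` removes the factor `β` that transposition introduces.
  C-sym : (α β : Congruence A ℓ) → Modular (Con (Pairs α)) → Modular (Con (Pairs β)) →
          (δ : Congruence A ℓ) → C α β δ → C β α δ
  C-sym α β modular-α modular-β δ = C-up β α modular-α (δ ∧ β) δ proj₁ ∘ C-transpose α β modular-β δ

-- Semidegeneracy and maximal congruences

module _ (em : ∀ {a} → ExcludedMiddle a) {S : Signature} {𝒱 : Pred (Algebra S ℓ) ℓ}
         (variety : IsVariety S 𝒱) (semidegenerate : Semidegenerate 𝒱) where

  module _ {B : Algebra S ℓ} (B∈𝒱 : B ∈ 𝒱) where
    open Algebra B using (_≈_; op; op-cong; sym; trans) renaming (refl to ≈-refl)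

    -- The class of `a` would be a one-element subalgebra.
    idempotent⇒trivial : ∀ a → (∀ f → op f (λ _ → a) ≈ a) → ∀ x y → x ≈ y
    idempotent⇒trivial a idem x y = em⇒dne em λ x≉y →
      semidegenerate B B∈𝒱 (x , y , x≉y)
        ( record
          { universe = _≈ a
          ; resp     = λ x≈y x≈a → trans (sym x≈y) x≈a
          ; closed   = λ f xs≈a → trans (op-cong f xs≈a) (idem f)
          }
        , a , ≈-refl , id)

  module _ {A : Algebra S ℓ} (A∈𝒱 : A ∈ 𝒱) where
    open Algebra A using (op)

    idempotent⇒full : (φ : Congruence A ℓ) → ∀ a → (∀ f → rel φ (op f (λ _ → a)) a) → ∇ A ⊑ φ
    idempotent⇒full φ a idem _ = idempotent⇒trivial (quotient∈𝒱 variety A∈𝒱 φ) a idem _ _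

  module _ {A : Algebra S ℓ} (A∈𝒱 : A ∈ 𝒱) where
    open Algebra A using (Carrier; op) renaming (refl to ≈-refl)

    D-full : (β : Congruence A ℓ) → ∇ (Pairs β) ⊑ D (∇ A) β
    D-full β {x , y , xβy} _ =
      idempotent⇒full (pairs∈𝒱 variety A∈𝒱 β) (D (∇ A) β) (fun (diagonal β) x)
        (λ f → by-trans (by-≈ (≈-refl , ≈-refl)) (D-base (∇ A) β (lift tt))) (lift tt)

    complements-cover : CongruenceModular 𝒱 → (γ γ′ : Congruence A ℓ) →
                        ∇ A ⊑ γ ∨ γ′ → γ ∧ γ′ ⊑ Δ A →
                        (δ : Congruence A ℓ) → (γ ∨ δ) ∧ (γ′ ∨ δ) ⊑ δ
    complements-cover modular γ γ′ ∇⊑γ∨γ′ γ∧γ′⊑Δ δ {x} {y} xκy =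
      -- As `D (∇ A) κ` is full, it relates `(x , x)` to `(x , y)` and carries `x δ x` to `x δ y`.
      C-mono (∇ A) (γ ∨ γ′) κ δ ∇⊑γ∨γ′
        (C-join γ γ′ κ δ (half γ′ γ proj₂ (γ∧γ′⊑Δ ∘ swap)) (half γ γ′ proj₁ γ∧γ′⊑Δ))
        {x , x , reflexive κ ≈-refl} {x , y , xκy} (D-full κ (lift tt)) (reflexive δ ≈-refl)
      where
      κ : Congruence A ℓ
      κ = (γ ∨ δ) ∧ (γ′ ∨ δ)

      modular-pairs : ∀ β → Modular (Con (Pairs β))
      modular-pairs β = modular (Pairs β) (pairs∈𝒱 variety A∈𝒱 β)

      -- Both `α` and `δ` centralize `β` modulo `δ`, hence so does `κ`, which is below their join;
      -- symmetry moves `κ` to the second place.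
      half : (α β : Congruence A ℓ) → κ ⊑ α ∨ δ → α ∧ β ⊑ Δ A → C β κ δ
      half α β κ⊑α∨δ α∧β⊑Δ =
        C-sym κ β (modular-pairs κ) (modular-pairs β) δ
          (C-mono κ (α ∨ δ) β δ κ⊑α∨δ
            (C-join α δ β δ (C-meet (modular A A∈𝒱) α β δ (reflexive δ ∘ α∧β⊑Δ)) (C-self β δ)))

    module _ (zorn : ∀ {c ℓ₁ ℓ₂ p} → Zorn c ℓ₁ ℓ₂ p)
             (χ : Congruence A ℓ) (χ-proper : ¬ χ ≋ ∇ A) (a : Carrier) where

      private
        Above : Set (suc ℓ)
        Above = ∃[ φ ] χ ⊑ φ × ¬ (φ ≋ ∇ A)

        above : Poset (suc ℓ) ℓ ℓ
        above = record
          { Carrier = Above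
          ; _≈_ = λ φ ψ → proj₁ φ ≋ proj₁ ψ
          ; _≤_ = λ φ ψ → proj₁ φ ⊑ proj₁ ψ
          ; isPartialOrder = record
            { isPreorder = record
              { isEquivalence = record
                { refl  = id , id
                ; sym   = swap
                ; trans = λ (f , g) (h , k) → h ∘ f , g ∘ k
                }
              ; reflexive = proj₁
              ; trans     = λ f g → g ∘ f
              }
            ; antisym = _,_
            }
          }

        open Poset above using (_≤_)

      module _ (K : Pred Above ℓ) (chain : ∀ {φ ψ} → φ ∈ K → ψ ∈ K → φ ≤ ψ ⊎ ψ ≤ φ) where

        private
          bottom : Above
          bottom = χ , id , χ-proper

          -- Adding χ makes the chain nonempty.
          K⁺ : Pred Above (suc ℓ)
          K⁺ φ = φ ≡ bottom ⊎ φ ∈ K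

          Union : Rel Carrier (suc ℓ)
          Union x y = ∃[ φ ] φ ∈ K⁺ × rel (proj₁ φ) x y

          upper : ∀ φ ψ → φ ∈ K⁺ → ψ ∈ K⁺ → ∃[ ω ] ω ∈ K⁺ × φ ≤ ω × ψ ≤ ω
          upper φ ψ (inj₁ refl) ψ∈K = ψ , ψ∈K , proj₁ (proj₂ ψ) , id
          upper φ ψ φ∈K (inj₁ refl) = φ , φ∈K , id , proj₁ (proj₂ φ)
          upper φ ψ (inj₂ φ∈K) (inj₂ ψ∈K) with chain φ∈K ψ∈K
          ... | inj₁ φ≤ψ = ψ , inj₂ ψ∈K , φ≤ψ , id
          ... | inj₂ ψ≤φ = φ , inj₂ φ∈K , id , ψ≤φ

          -- In a chain, finitely many pairs of the union lie in a single member. This serves the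
          -- arguments of one operation and also the family of all symbols.
          uniform : ∀ n {xs ys : Fin n → Carrier} → (∀ i → Union (xs i) (ys i)) →
                    ∃[ ω ] ω ∈ K⁺ × (∀ i → rel (proj₁ ω) (xs i) (ys i))
          uniform zero    us = bottom , inj₁ refl , λ ()
          uniform (ℕ.suc n) us =
            let φ , φ∈K , r = us zero
                ψ , ψ∈K , rs = uniform n (us ∘ Fin.suc)
                ω , ω∈K , φ≤ω , ψ≤ω = upper φ ψ φ∈K ψ∈K
            in ω , ω∈K , λ { zero → φ≤ω r ; (Fin.suc i) → ψ≤ω (rs i) }

          -- Excluded middle resizes the union from Set (suc ℓ) to Set ℓ.
          Resized : Rel Carrier ℓ
          Resized x y = Lift ℓ (True (em {P = Union x y}))

          shrink : Union ⇒ Resized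
          shrink = lift ∘ fromWitness

          grow : Resized ⇒ Union
          grow = toWitness ∘ lower

          union : Congruence A ℓ
          union = record
            { rel        = Resized
            ; reflexive  = λ e → shrink (bottom , inj₁ refl , reflexive χ e)
            ; symmetric  = λ s → let φ , φ∈K , r = grow s in shrink (φ , φ∈K , symmetric (proj₁ φ) r)
            ; transitive = λ s t →
                let φ , φ∈K , r = grow s
                    ψ , ψ∈K , r′ = grow t
                    ω , ω∈K , φ≤ω , ψ≤ω = upper φ ψ φ∈K ψ∈K
                in shrink (ω , ω∈K , transitive (proj₁ ω) (φ≤ω r) (ψ≤ω r′))
            ; compatible = λ f s →
                let ω , ω∈K , r = uniform _ (λ i → grow (s i))
                in shrink (ω , ω∈K , compatible (proj₁ ω) f r)
            }

          -- Finiteness of the signature enters here: if the union were full, one member would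
          -- contain all pairs `(f(a,…,a) , a)` and be full itself.
          union-proper : ¬ union ≋ ∇ A
          union-proper (_ , ∇⊑union) =
            let (ω , _ , ω-proper) , _ , r =
                  uniform _ {λ f → op f (λ _ → a)} {λ _ → a} (λ f → grow (∇⊑union (lift tt)))
            in ω-proper ((λ _ → lift tt) , idempotent⇒full A∈𝒱 ω a r)

        chain-bounded : ∃[ υ ] (∀ {φ} → φ ∈ K → φ ≤ υ)
        chain-bounded =
          ( union , (λ r → shrink (bottom , inj₁ refl , r)) , union-proper)
          , λ {φ} φ∈K r → shrink (φ , inj₂ φ∈K , r)

      maximal-above : ∃[ μ ] χ ⊑ μ × Maximal (Con A) μ
      maximal-above =
        let (μ , χ⊑μ , μ-proper) , maximal = zorn above chain-bounded
        in μ , χ⊑μ , μ-proper , λ φ μ⊑φ φ-proper → maximal (φ , μ⊑φ ∘ χ⊑μ , φ-proper) μ⊑φ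

    join-Rad-full : (∀ {c ℓ₁ ℓ₂ p} → Zorn c ℓ₁ ℓ₂ p) → (θ : Congruence A ℓ) → θ ⊑ Rad A →
                    (χ : Congruence A ℓ) → ∇ A ⊑ χ ∨ θ → ∇ A ⊑ χ
    join-Rad-full zorn θ θ⊑Rad χ ∇⊑χ∨θ {x} {y} _ = em⇒dne em λ x≁y →
      -- A pair outside `χ` makes `χ` proper and also supplies the element from which
      -- `maximal-above` starts. The maximal `μ` contains both `χ` and `θ`, hence `∇`.
      let μ , χ⊑μ , maximal = maximal-above zorn χ (λ (_ , ∇⊑χ) → x≁y (∇⊑χ (lift tt))) x
      in proj₁ maximal
           ((λ _ → lift tt) , Cg-least μ [ χ⊑μ , (λ s → θ⊑Rad s μ maximal) ]′ ∘ ∇⊑χ∨θ)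

-- The map p•

module _ {A : Algebra S ℓ} where

  Complemented-resp : (φ ψ : Congruence A ℓ) → φ ≋ ψ →
                      Complemented (Con A) φ → Complemented (Con A) ψ
  Complemented-resp φ ψ (φ⊑ψ , ψ⊑φ) (φ′ , (_ , ∇⊑φ∨φ′) , (φ∧φ′⊑Δ , _)) =
    φ′ , ((λ _ → lift tt) , Cg-least (ψ ∨ φ′) (base ∘ Sum.map₁ φ⊑ψ) ∘ ∇⊑φ∨φ′)
       , ((λ (r , r′) → φ∧φ′⊑Δ (ψ⊑φ r , r′)) , reflexive (ψ ∧ φ′))

module _ {A : Algebra S ℓ} (θ : Congruence A ℓ) where

  ∨-monoˡ : (φ ψ : Congruence A ℓ) → φ ⊑ ψ → φ ∨ θ ⊑ ψ ∨ θ
  ∨-monoˡ φ ψ φ⊑ψ = Cg-least (ψ ∨ θ) (base ∘ Sum.map₁ φ⊑ψ)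

  p•-cong : (φ ψ : Congruence A ℓ) → φ ≋ ψ → p• θ φ ≋ p• θ ψ
  p•-cong φ ψ (φ⊑ψ , ψ⊑φ) = ∨-monoˡ φ ψ φ⊑ψ , ∨-monoˡ ψ φ ψ⊑φ

-- Lifting sets of atoms

theorem7p4 : (em : ∀ {a} → ExcludedMiddle a) →
    (zorn : ∀ {c ℓ₁ ℓ₂ p} → Zorn c ℓ₁ ℓ₂ p) →
    ∀ {ℓ : Level} (S : Signature) (𝒱 : Pred (Algebra S ℓ) ℓ) →
    IsVariety S 𝒱 →
    CongruenceModular 𝒱 →
    Semidegenerate 𝒱 →
    CompactClosedUnderCommutator 𝒱 →
    (A : Algebra S ℓ) → A ∈ 𝒱 →
    (θ : Congruence A ℓ) → θ ⊑ Rad A →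
    CBLP θ →
    (Ω′ : Subset (Con (A / θ)) (suc ℓ)) →
    member Ω′ ⊆ AtomOfB (Con (A / θ)) →
    ∃[ Ω ]
    (member Ω ⊆ Complemented (Con A) × Lifts θ Ω′ Ω
    × (∀ (Ω₁ : Subset (Con A) (suc ℓ)) →
    member Ω₁ ⊆ Complemented (Con A) → Lifts θ Ω′ Ω₁ → member Ω₁ ≐ member Ω))
    × member Ω ⊆ AtomOfB (Con A)
theorem7p4 em zorn {ℓ} S 𝒱 variety modular semidegenerate _ A A∈𝒱 θ θ⊑Rad cblp Ω′ Ω′⊆Atoms =
  Ω , (proj₁ , lifts , unique) , λ {α} → atoms {α}
  where
  cover = complements-cover em variety semidegenerate A∈𝒱 modular

  p•-complemented : ∀ {γ} → Complemented (Con A) γ → Complemented (Con (A / θ)) (p• θ γ)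
  p•-complemented {γ} (γ′ , (_ , ∇⊑γ∨γ′) , (γ∧γ′⊑Δ , _)) =
    p• θ γ′
    , ( (λ _ → lift tt)
      -- The pullback reads a congruence of `A / θ` as one of `A`, so that it can be compared with
      -- `γ ∨ γ′`.
      , Cg-least (pullback (quotient-hom θ) (p• θ γ ∨ p• θ γ′))
          (base ∘ Sum.map (base ∘ inj₁) (base ∘ inj₁)) ∘ ∇⊑γ∨γ′)
    -- The meet is (1) with `θ` for `δ`.
    , (cover γ γ′ ∇⊑γ∨γ′ γ∧γ′⊑Δ θ , reflexive (p• θ γ ∧ p• θ γ′))

  p•-reflects : ∀ {γ δ} → Complemented (Con A) γ → p• θ γ ⊑ p• θ δ → γ ⊑ δ
  p•-reflects {γ} {δ} (γ′ , (_ , ∇⊑γ∨γ′) , (γ∧γ′⊑Δ , _)) γ∨θ⊑δ∨θ xγy =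
    cover γ γ′ ∇⊑γ∨γ′ γ∧γ′⊑Δ δ
      ( base (inj₁ xγy)
      , join-Rad-full em variety semidegenerate A∈𝒱 zorn θ θ⊑Rad (γ′ ∨ δ) ∇⊑γ′∨δ∨θ (lift tt))
    where
    ∇⊑γ′∨δ∨θ : ∇ A ⊑ (γ′ ∨ δ) ∨ θ
    ∇⊑γ′∨δ∨θ = Cg-least ((γ′ ∨ δ) ∨ θ)
      [ ∨-monoˡ θ δ (γ′ ∨ δ) (base ∘ inj₂) ∘ γ∨θ⊑δ∨θ ∘ base ∘ inj₁ , base ∘ inj₁ ∘ base ∘ inj₁ ]′ ∘ ∇⊑γ∨γ′

  -- The full preimage of `Ω′` among complemented congruences; every lift inside `B(Con A)` is
  -- contained in it.
  Ω : Subset (Con A) (suc ℓ)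
  Ω = record
    { member   = λ α → Complemented (Con A) α × p• θ α ∈ member Ω′
    ; respects = λ {α} {α₁} α≋α₁ (α-comp , p•α∈Ω′) →
        Complemented-resp α α₁ α≋α₁ α-comp , respects Ω′ (p•-cong θ α α₁ α≋α₁) p•α∈Ω′
    }

  lifts : Lifts θ Ω′ Ω
  lifts β = mk⇔
    (λ β∈Ω′ → let α , α-comp , p•α≋β = cblp β (proj₁ (Ω′⊆Atoms β∈Ω′))
              in α , (α-comp , respects Ω′ (swap p•α≋β) β∈Ω′) , p•α≋β)
    (λ (α , (_ , p•α∈Ω′) , p•α≋β) → respects Ω′ p•α≋β p•α∈Ω′)

  unique : ∀ (Ω₁ : Subset (Con A) (suc ℓ)) → member Ω₁ ⊆ Complemented (Con A) → Lifts θ Ω′ Ω₁ →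
           member Ω₁ ≐ member Ω
  unique Ω₁ Ω₁⊆B lifts₁ =
    (λ {α} α∈Ω₁ → Ω₁⊆B α∈Ω₁ , Equivalence.from (lifts₁ (p• θ α)) (α , α∈Ω₁ , id , id)) ,
    -- Some `α₁` in `Ω₁` has the same image as `α`, and reflecting the order both ways identifies
    -- them.
    (λ {α} (α-comp , p•α∈Ω′) →
      let α₁ , α₁∈Ω₁ , (p•α₁⊑ , p•α⊑) = Equivalence.to (lifts₁ (p• θ α)) p•α∈Ω′
      in respects Ω₁ (p•-reflects {α₁} {α} (Ω₁⊆B α₁∈Ω₁) p•α₁⊑ , p•-reflects {α} {α₁} α-comp p•α⊑) α₁∈Ω₁)

  atoms : member Ω ⊆ AtomOfB (Con A)
  atoms {α} (α-comp , p•α∈Ω′) =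
    let _ , p•α≉⊥ , p•α-atom = Ω′⊆Atoms p•α∈Ω′ in
    α-comp ,
    -- If `α` were `Δ`, its image would be `θ`, the bottom of `Con (A / θ)`.
    (λ (α⊑Δ , _) → p•α≉⊥ (Cg-least θ [ reflexive θ ∘ α⊑Δ , id ]′ , reflexive (p• θ α))) ,
    λ y y-comp y⊑α → Sum.map
      -- The bottom of `Con (A / θ)` lies below the image of `Δ A`, so reflection gives `y ⊑ Δ A`.
      (λ (p•y⊑⊥ , _) → p•-reflects {y} {Δ A} y-comp (base ∘ inj₂ ∘ p•y⊑⊥) , reflexive y)
      (λ (_ , p•α⊑p•y) → y⊑α , p•-reflects {α} {y} α-comp p•α⊑p•y)
      (p•α-atom (p• θ y) (p•-complemented {y} y-comp) (∨-monoˡ θ y α y⊑α))
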